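{- $\mathbf{S4DS}$ is the D-logic of the class of all dense-in-itself topological spaces; that is, for every bimodal formula $A$, one has $A\in\mathbf{S4DS}$ if and only if $A$ is valid in every dense-in-itself topological space.
   Context: Formulas are built by $\phi ::= p \mid \bot \mid \phi\to\phi \mid \Box\phi \mid [\neq]\phi$, with $p$ ranging over propositional letters; the other Boolean connectives are the usual abbreviations, $\Diamond A=\neg\Box\neg A$, $\langle\neq\rangle A=\neg[\neq]\neg A$, and $[\forall]A=[\neq]A\wedge A$. A (bimodal) logic is a set of formulas containing all classical tautologies, $\Box(p\to q)\to(\Box p\to\Box q)$ and $[\neq](p\to q)\to([\neq]p\to[\neq]q)$, and closed under Substitution, Modus Ponens, and the two Generalization rules $A/\Box A$ and $A/[\neq]A$. $\mathbf{K_2}$ is the minimal logic, and $L+\Gamma$ is the minimal logic containing the logic $L$ and the set of formulas $\Gamma$. $\mathbf{S4D}=\mathbf{K_2}+\{B_D,4_D^-,D_\Box,T_\Box,4_\Box\}$ and $\mathbf{S4DS}=\mathbf{S4D}+DS$, where $B_D$ is $p\to[\neq]\langle\neq\rangle p$; $4_D^-$ is $(p\wedge[\neq]p)\to[\neq][\neq]p$; $D_\Box$ is $[\forall]p\to\Box p$; $T_\Box$ is $\Box p\to p$; $4_\Box$ is $\Box p\to\Box\Box p$; $DS$ is $[\neq]p\to\Diamond p$. Topological semantics: a valuation $\theta$ on a topological space $\mathfrak X$ assigns to each propositional letter a subset of $\mathfrak X$. Truth at a point is defined by: $\mathfrak X,\theta,x\models p$ iff $x\in\theta(p)$; $\bot$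 is never true; $\to$ is interpreted classically; $\mathfrak X,\theta,x\models\Box\phi$ iff there is a neighborhood $U$ of $x$ with $\mathfrak X,\theta,y\models\phi$ for all $y\in U$; $\mathfrak X,\theta,x\models[\neq]\phi$ iff $\mathfrak X,\theta,y\models\phi$ for all $y\neq x$. A formula is valid in $\mathfrak X$ if it is true at every point under every valuation. The D-logic of a class of spaces is the set of all formulas valid in all spaces of the class. A point $x$ of $\mathfrak X$ is isolated if $\{x\}$ is open; $\mathfrak X$ is dense-in-itself if it has no isolated points. -}

module Defs where

open import Level using (Level; Lift; suc; 0ℓ)
open import Data.Bool using (Bool; true; false; not; _∨_)
open import Data.Empty.Polymorphic using (⊥)
open import Data.List using (_∷_; [])
import Data.List.Membership.Propositional as List
open import Data.Nat using (ℕ)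
open import Data.Product using (∃; _×_)
open import Data.Unit.Polymorphic using (⊤)
open import Relation.Binary.PropositionalEquality using (_≡_; _≢_)
open import Relation.Nullary using (¬_)
open import Relation.Unary using (Pred; _∈_; _⊆_; _≐_; _∪_; _∩_; ∅; ｛_｝; ⋃)

infixr 5 _⇒_
infixr 6 _∧ᶠ_
infix  8 □_ ◇_ [≠]_ ⟨≠⟩_ [∀]_ ¬ᶠ_

data Form : Set where
  var  : ℕ → Form
  ⊥ᶠ   : Form
  _⇒_  : Form → Form → Form
  □_   : Form → Form
  [≠]_ : Form → Form

¬ᶠ_ ◇_ ⟨≠⟩_ [∀]_ : Form → Form
_∧ᶠ_ : Form → Form → Form
¬ᶠ A   = A ⇒ ⊥ᶠ
A ∧ᶠ B = ¬ᶠ (A ⇒ ¬ᶠ B)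
◇ A    = ¬ᶠ (□ (¬ᶠ A))
⟨≠⟩ A  = ¬ᶠ ([≠] (¬ᶠ A))
[∀] A  = ([≠] A) ∧ᶠ A

_[_] : Form → (ℕ → Form) → Form
var n   [ σ ] = σ n
⊥ᶠ      [ σ ] = ⊥ᶠ
(A ⇒ B) [ σ ] = (A [ σ ]) ⇒ (B [ σ ])
(□ A)   [ σ ] = □ (A [ σ ])
([≠] A) [ σ ] = [≠] (A [ σ ])

-- Only the values of v at letters and at formulas □ A, [≠] A are used: for
-- the purposes of classical propositional logic these count as atoms.
eval : (Form → Bool) → Form → Bool
eval v (var n) = v (var n)
eval v ⊥ᶠ      = false
eval v (A ⇒ B) = not (eval v A) ∨ eval v B
eval v (□ A)   = v (□ A)
eval v ([≠] A) = v ([≠] A)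

Tautology : Pred Form 0ℓ
Tautology A = ∀ v → eval v A ≡ true

p q : Form
p = var 0
q = var 1

K-□ K-≠ : Form
K-□ = □ (p ⇒ q) ⇒ (□ p ⇒ □ q)
K-≠ = [≠] (p ⇒ q) ⇒ ([≠] p ⇒ [≠] q)

record IsLogic {ℓ} (L : Pred Form ℓ) : Set ℓ where
  field
    tautology    : ∀ {A} → A ∈ Tautology → A ∈ L
    k-□          : K-□ ∈ L
    k-≠          : K-≠ ∈ L
    substitution : ∀ {A} (σ : ℕ → Form) → A ∈ L → (A [ σ ]) ∈ L
    modusPonens  : ∀ {A B} → (A ⇒ B) ∈ L → A ∈ L → B ∈ L
    gen-□        : ∀ {A} → A ∈ L → (□ A) ∈ L
    gen-≠        : ∀ {A} → A ∈ L → ([≠] A) ∈ L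

-- The minimal logic containing Γ; see Least-isLogic and Least-minimal.
data Least (Γ : Pred Form 0ℓ) : Pred Form 0ℓ where
  axiom        : ∀ {A} → A ∈ Γ → Least Γ A
  tautology    : ∀ {A} → A ∈ Tautology → Least Γ A
  k-□          : Least Γ K-□
  k-≠          : Least Γ K-≠
  substitution : ∀ {A} (σ : ℕ → Form) → Least Γ A → Least Γ (A [ σ ])
  modusPonens  : ∀ {A B} → Least Γ (A ⇒ B) → Least Γ A → Least Γ B
  gen-□        : ∀ {A} → Least Γ A → Least Γ (□ A)
  gen-≠        : ∀ {A} → Least Γ A → Least Γ ([≠] A)

Least-isLogic : ∀ Γ → IsLogic (Least Γ)
Least-isLogic Γ = record
  { tautology = tautology ; k-□ = k-□ ; k-≠ = k-≠ ; substitution = substitution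
  ; modusPonens = modusPonens ; gen-□ = gen-□ ; gen-≠ = gen-≠ }

Least-minimal : ∀ {ℓ Γ} {L : Pred Form ℓ} → IsLogic L → Γ ⊆ L → Least Γ ⊆ L
Least-minimal {Γ = Γ} {L} isL Γ⊆L = go
  where
  module L = IsLogic isL
  go : ∀ {A} → Least Γ A → L A
  go (axiom a)          = Γ⊆L a
  go (tautology t)      = L.tautology t
  go k-□                = L.k-□
  go k-≠                = L.k-≠
  go (substitution σ d) = L.substitution σ (go d)
  go (modusPonens d e)  = L.modusPonens (go d) (go e)
  go (gen-□ d)          = L.gen-□ (go d)
  go (gen-≠ d)          = L.gen-≠ (go d)

K₂ : Pred Form 0ℓ
K₂ = Least ∅

infixl 6 _+ᴸ_
_+ᴸ_ : Pred Form 0ℓ → Pred Form 0ℓ → Pred Form 0ℓ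
L +ᴸ Γ = Least (L ∪ Γ)

B-D 4⁻-D D-□ T-□ 4-□ DS : Form
B-D  = p ⇒ [≠] (⟨≠⟩ p)
4⁻-D = (p ∧ᶠ ([≠] p)) ⇒ [≠] ([≠] p)
D-□  = [∀] p ⇒ □ p
T-□  = □ p ⇒ p
4-□  = □ p ⇒ □ (□ p)
DS   = [≠] p ⇒ ◇ p

S4D S4DS : Pred Form 0ℓ
S4D  = K₂ +ᴸ (List._∈ (B-D ∷ 4⁻-D ∷ D-□ ∷ T-□ ∷ 4-□ ∷ []))
S4DS = S4D +ᴸ ｛ DS ｝

-- Subsets are predicates, so openness must be required to be invariant under
-- extensional equality (Open-resp-≐).
record Space (ℓ : Level) : Set (suc ℓ) where
  field
    Carrier     : Set ℓ
    Open        : Pred (Pred Carrier ℓ) ℓ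
    Open-resp-≐ : ∀ {U V} → U ≐ V → Open U → Open V
    Open-∅      : Open (λ _ → ⊥)
    Open-U      : Open (λ _ → ⊤)
    Open-∩      : ∀ {U V} → Open U → Open V → Open (U ∩ V)
    Open-⋃      : ∀ (I : Set ℓ) (U : I → Pred Carrier ℓ) →
                  (∀ i → Open (U i)) → Open (⋃ I U)

  Neighborhood : Carrier → Pred (Pred Carrier ℓ) (suc ℓ)
  Neighborhood x U = ∃ λ V → Open V × x ∈ V × V ⊆ U

  Isolated : Pred Carrier ℓ
  Isolated x = Open ｛ x ｝

DenseInItself : ∀ {ℓ} → Pred (Space ℓ) ℓ
DenseInItself X = ∀ x → ¬ Isolated x
  where open Space X

module _ {ℓ} (X : Space ℓ) where
  open Space X

  Valuation : Set (suc ℓ)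
  Valuation = ℕ → Pred Carrier ℓ

  infix 4 _,_⊨_
  _,_⊨_ : Valuation → Carrier → Form → Set (suc ℓ)
  θ , x ⊨ var n = Lift (suc ℓ) (x ∈ θ n)
  θ , x ⊨ ⊥ᶠ    = ⊥
  θ , x ⊨ A ⇒ B = θ , x ⊨ A → θ , x ⊨ B
  θ , x ⊨ □ A   = ∃ λ U → Neighborhood x U × (∀ y → y ∈ U → θ , y ⊨ A)
  θ , x ⊨ [≠] A = ∀ y → y ≢ x → θ , y ⊨ A

  Valid : Pred Form (suc ℓ)
  Valid A = ∀ θ x → θ , x ⊨ A

D-logic : ∀ {ℓ ℓ′} → Pred (Space ℓ) ℓ′ → Pred Form _
D-logic C A = ∀ X → X ∈ C → Valid X A

-- Completeness: filtrate the canonical model, restricted to the theories related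
-- to a fixed one by [∀], through the subformulas of A, keeping the preorder for □
-- transitive in Lemmon's way. Any two distinct points of the quotient are
-- D-related, so it is a model over difference except that some points are
-- D-related to themselves. Doubling those points turns D into genuine
-- difference, and DS makes the Alexandrov topology of the preorder dense-in-itself.
module Submission where

open import Level using (Level; suc; 0ℓ; Lift; lift; lower)
open import Axiom.ExcludedMiddle using (ExcludedMiddle)
open import Data.Bool using (Bool; true; false; not)
import Data.Bool.Properties as Bool
open import Data.Empty using (⊥-elim)
open import Data.List using (List; []; _∷_; _++_; map; upTo; cartesianProductWith)
open import Data.List.Properties using (∷-injectiveˡ; ∷-injectiveʳ; ≡-dec; map-cong)
import Data.List.Membership.Propositional as List
open import Data.List.Membership.Propositional.Properties
  using (∈-map⁺; ∈-++⁺ˡ; ∈-++⁺ʳ; ∈-upTo⁺; ∈-cartesianProductWith⁺)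
open import Data.List.Relation.Unary.Any using (here; there)
open import Data.Nat using (ℕ; zero; _⊔_; _≤_; s≤s; _≤′_; ≤′-refl; ≤′-step)
open import Data.Nat.Properties
  using (≤-refl; ≤⇒≤′; m≤m⊔n; m≤n⊔m; m⊔n≤o⇒m≤o; m⊔n≤o⇒n≤o)
open import Data.Product using (∃; ∃₂; _×_; _,_; proj₁; proj₂)
import Data.Sum as Sum
open import Data.Sum using (_⊎_; inj₁; inj₂; [_,_]; map₁; map₂)
open import Function using (_∘_; id)
open import Function.Bundles using (_⇔_; mk⇔)
open import Relation.Binary.PropositionalEquality
  using (_≡_; _≢_; refl; sym; trans; cong; subst)
open import Relation.Nullary using (¬_; Dec; yes; no; does; proof; contradiction; Reflects; ofʸ; ofⁿ)
open import Relation.Nullary.Decidable using (map′; dec-true; decidable-stable; recompute)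
open import Relation.Nullary.Reflects using (_→-reflects_)
open import Relation.Unary using (Pred; _∈_; _⊆_; _∪_; ｛_｝)
open import Defs

does⁻ : ∀ {a} {P : Set a} (P? : Dec P) → does P? ≡ true → P
does⁻ (yes p) _ = p

-- Soundness

module Soundness {ℓ} (em : ExcludedMiddle (suc ℓ)) (X : Space ℓ) where
  open Space X

  infix 4 _,_⊩_
  _,_⊩_ : Valuation X → Carrier → Form → Set (suc ℓ)
  θ , x ⊩ B = (_,_⊨_ X) θ x B

  _≟_ : (x y : Carrier) → Dec (x ≡ y)
  x ≟ y = map′ lower lift (em {Lift (suc ℓ) (x ≡ y)})

  truth-value : Valuation X → Carrier → Form → Bool
  truth-value θ x B = does (em {θ , x ⊩ B})

  -- `eval` consults the Boolean valuation only at letters and modal formulas. There excluded middle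
  -- makes it agree with truth at x, and implication preserves the agreement.
  eval-reflects : ∀ θ x B → Reflects (θ , x ⊩ B) (eval (truth-value θ x) B)
  eval-reflects θ x (var n) = proof em
  eval-reflects θ x ⊥ᶠ      = ofⁿ lower
  eval-reflects θ x (B ⇒ C) = eval-reflects θ x B →-reflects eval-reflects θ x C
  eval-reflects θ x (□ B)   = proof em
  eval-reflects θ x ([≠] B) = proof em

  tautology-valid : ∀ {B} → B ∈ Tautology → Valid X B
  tautology-valid {B} t θ x
    with eval (truth-value θ x) B | eval-reflects θ x B | t (truth-value θ x)
  ... | true | ofʸ b | refl = b

  module _ (θ : Valuation X) (σ : ℕ → Form) where
    -- Truth of `σ n` lives one universe too high to be a subset of the space; its Boolean truth
    -- value, decided by excluded middle, brings it down.
    pullback : Valuation X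
    pullback n x = Lift ℓ (truth-value θ x (σ n) ≡ true)

    to   : ∀ x B → pullback , x ⊩ B → θ , x ⊩ B [ σ ]
    from : ∀ x B → θ , x ⊩ B [ σ ] → pullback , x ⊩ B
    to x (var n) (lift (lift e)) = does⁻ em e
    to x (B ⇒ C) f b             = to x C (f (from x B b))
    to x (□ B) (U , N , f)       = U , N , λ y y∈U → to y B (f y y∈U)
    to x ([≠] B) f y y≢x         = to y B (f y y≢x)
    from x (var n) s             = lift (lift (dec-true em s))
    from x (B ⇒ C) f b           = from x C (f (to x B b))
    from x (□ B) (U , N , f)     = U , N , λ y y∈U → from y B (f y y∈U)
    from x ([≠] B) f y y≢x       = from y B (f y y≢x)

  k-□-valid : Valid X K-□
  k-□-valid θ x (U , (V , oV , x∈V , V⊆U) , f) (U′ , (V′ , oV′ , x∈V′ , V′⊆U′) , g) =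
    _ , (_ , Open-∩ oV oV′ , (x∈V , x∈V′) , id) ,
    λ y (y∈V , y∈V′) → f y (V⊆U y∈V) (g y (V′⊆U′ y∈V′))

  isLogic : IsLogic (Valid X)
  isLogic = record
    { tautology    = λ {B} → tautology-valid {B}
    ; k-□          = k-□-valid
    ; k-≠          = λ θ x f g y y≢x → f y y≢x (g y y≢x)
    ; substitution = λ {B} σ v θ x → to θ σ x B (v (pullback θ σ) x)
    ; modusPonens  = λ f b θ x → f θ x (b θ x)
    ; gen-□        = λ b θ x → _ , (_ , Open-U , _ , id) , λ y _ → b θ y
    ; gen-≠        = λ b θ x y _ → b θ y
    }

  ∧-elim : ∀ θ x B C → θ , x ⊩ B ∧ᶠ C → θ , x ⊩ B × θ , x ⊩ C
  ∧-elim θ x B C h = decidable-stable em λ n → lower (h λ b c → lift (n (b , c)))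

  [∀]-elim : ∀ θ x B → θ , x ⊩ [∀] B → ∀ y → θ , y ⊩ B
  [∀]-elim θ x B h y with ∧-elim θ x ([≠] B) B h | y ≟ x
  ... | f , b | yes refl = b
  ... | f , b | no y≢x   = f y y≢x

  B-D-valid : Valid X B-D
  B-D-valid θ x b y y≢x f = f x (y≢x ∘ sym) b

  4⁻-D-valid : Valid X 4⁻-D
  4⁻-D-valid θ x h y _ z _ with ∧-elim θ x p ([≠] p) h | z ≟ x
  ... | b , f | yes refl = b
  ... | b , f | no z≢x   = f z z≢x

  D-□-valid : Valid X D-□
  D-□-valid θ x h = _ , (_ , Open-U , _ , id) , λ y _ → [∀]-elim θ x p h y

  T-□-valid : Valid X T-□
  T-□-valid θ x (U , (V , _ , x∈V , V⊆U) , f) = f x (V⊆U x∈V)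

  4-□-valid : Valid X 4-□
  4-□-valid θ x (U , (V , oV , x∈V , V⊆U) , f) =
    V , (V , oV , x∈V , id) , λ y y∈V → U , (V , oV , y∈V , V⊆U) , f

  -- A failure gives an open V around x on which p is false, while p holds at every point other than
  -- x. Then V is the singleton of x, so x is isolated.
  DS-valid : X ∈ DenseInItself → Valid X DS
  DS-valid dense θ x f (U , (V , oV , x∈V , V⊆U) , g) =
    contradiction (Open-resp-≐ (V⊆x , λ { refl → x∈V }) oV) (dense x)
    where
    V⊆x : V ⊆ ｛ x ｝
    V⊆x {y} y∈V with y ≟ x
    ... | yes refl = refl
    ... | no y≢x   = ⊥-elim (lower (g y (V⊆U y∈V) (f y y≢x)))

  S4DS-valid : X ∈ DenseInItself → S4DS ⊆ Valid X
  -- Each `+ᴸ` is a layer of `Least`, so minimality is used for `DS`, for the five axioms of `S4D`,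
  -- and for `K₂`.
  S4DS-valid dense = Least-minimal isLogic λ
    { (inj₁ d) → Least-minimal isLogic (λ
        { (inj₁ e) → Least-minimal isLogic (λ ()) e
        ; (inj₂ (here refl)) → B-D-valid
        ; (inj₂ (there (here refl))) → 4⁻-D-valid
        ; (inj₂ (there (there (here refl)))) → D-□-valid
        ; (inj₂ (there (there (there (here refl))))) → T-□-valid
        ; (inj₂ (there (there (there (there (here refl)))))) → 4-□-valid
        }) d
    ; (inj₂ refl) → DS-valid dense
    }

-- Propositional tautologies

I-taut : ∀ B → (B ⇒ B) ∈ Tautology
I-taut B v with eval v B
... | true  = refl
... | false = refl

K-taut : ∀ B C → (B ⇒ (C ⇒ B)) ∈ Tautology
K-taut B C v with eval v B | eval v C
... | true  | true  = refl
... | true  | false = refl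
... | false | true  = refl
... | false | false = refl

S-taut : ∀ B C E → ((B ⇒ (C ⇒ E)) ⇒ ((B ⇒ C) ⇒ (B ⇒ E))) ∈ Tautology
S-taut B C E v with eval v B | eval v C | eval v E
... | true  | true  | true  = refl
... | true  | true  | false = refl
... | true  | false | _     = refl
... | false | true  | _     = refl
... | false | false | _     = refl

ex-falso-taut : ∀ B → (⊥ᶠ ⇒ B) ∈ Tautology
ex-falso-taut B v = refl

cases-taut : ∀ B C → ((B ⇒ C) ⇒ ((¬ᶠ B ⇒ C) ⇒ C)) ∈ Tautology
cases-taut B C v with eval v B | eval v C
... | true  | true  = refl
... | true  | false = refl
... | false | true  = refl
... | false | false = refl

∧-intro-taut : ∀ B C → (B ⇒ (C ⇒ (B ∧ᶠ C))) ∈ Tautology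
∧-intro-taut B C v with eval v B | eval v C
... | true  | true  = refl
... | true  | false = refl
... | false | true  = refl
... | false | false = refl

∧-elimˡ-taut : ∀ B C → ((B ∧ᶠ C) ⇒ B) ∈ Tautology
∧-elimˡ-taut B C v with eval v B | eval v C
... | true  | true  = refl
... | true  | false = refl
... | false | true  = refl
... | false | false = refl

∧-elimʳ-taut : ∀ B C → ((B ∧ᶠ C) ⇒ C) ∈ Tautology
∧-elimʳ-taut B C v with eval v B | eval v C
... | true  | true  = refl
... | true  | false = refl
... | false | true  = refl
... | false | false = refl

-- Lindenbaum's lemma

-- Finite lists that together exhaust the language; repetitions do no harm in Lindenbaum's
-- construction.
forms : ℕ → List Form
forms zero      = []
forms (ℕ.suc n) = ⊥ᶠ ∷ map var (upTo n) ++ map □_ (forms n) ++ map [≠]_ (forms n)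
                  ++ cartesianProductWith _⇒_ (forms n) (forms n)

rank : Form → ℕ
-- `forms (suc m)` lists only the letters below m, so the n-th letter first appears at n + 2.
rank (var n) = ℕ.suc (ℕ.suc n)
rank ⊥ᶠ      = 1
rank (B ⇒ C) = ℕ.suc (rank B ⊔ rank C)
rank (□ B)   = ℕ.suc (rank B)
rank ([≠] B) = ℕ.suc (rank B)

∈-forms : ∀ B {n} → rank B ≤ n → B List.∈ forms n
∈-forms (var k) (s≤s r) = there (∈-++⁺ˡ (∈-map⁺ var (∈-upTo⁺ r)))
∈-forms ⊥ᶠ      (s≤s _) = here refl
∈-forms (B ⇒ C) {ℕ.suc n} (s≤s r) =
  there (∈-++⁺ʳ (map var (upTo n)) (∈-++⁺ʳ (map □_ (forms n)) (∈-++⁺ʳ (map [≠]_ (forms n))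
    (∈-cartesianProductWith⁺ _⇒_ (∈-forms B (m⊔n≤o⇒m≤o _ _ r)) (∈-forms C (m⊔n≤o⇒n≤o (rank B) _ r))))))
∈-forms (□ B) {ℕ.suc n} (s≤s r) =
  there (∈-++⁺ʳ (map var (upTo n)) (∈-++⁺ˡ (∈-map⁺ □_ (∈-forms B r))))
∈-forms ([≠] B) {ℕ.suc n} (s≤s r) =
  there (∈-++⁺ʳ (map var (upTo n)) (∈-++⁺ʳ (map □_ (forms n)) (∈-++⁺ˡ (∈-map⁺ [≠]_ (∈-forms B r)))))

-- Derivations from hypotheses and complete theories

module Derivability {L : Pred Form 0ℓ} (isLogic : IsLogic L) where
  module L = IsLogic isLogic

  infix 4 _⊢_
  -- Generalization is available only inside L, never on hypotheses. This is what makes the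
  -- deduction theorem hold.
  data _⊢_ (X : Pred Form 0ℓ) : Pred Form 0ℓ where
    hyp : ∀ {B} → B ∈ X → X ⊢ B
    thm : ∀ {B} → B ∈ L → X ⊢ B
    mp  : ∀ {B C} → X ⊢ B ⇒ C → X ⊢ B → X ⊢ C

  taut : ∀ {X} B → B ∈ Tautology → X ⊢ B
  taut B t = thm (L.tautology {B} t)

  weaken : ∀ {X Y B} → X ⊆ Y → X ⊢ B → Y ⊢ B
  weaken X⊆Y (hyp h)  = hyp (X⊆Y h)
  weaken X⊆Y (thm t)  = thm t
  weaken X⊆Y (mp d e) = mp (weaken X⊆Y d) (weaken X⊆Y e)

  const : ∀ {X B} C → X ⊢ B → X ⊢ C ⇒ B
  const {B = B} C d = mp (taut (B ⇒ (C ⇒ B)) (K-taut B C)) d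

  identity : ∀ {X} B → X ⊢ B ⇒ B
  identity B = taut (B ⇒ B) (I-taut B)

  distribute : ∀ {X B C E} → X ⊢ B ⇒ (C ⇒ E) → X ⊢ B ⇒ C → X ⊢ B ⇒ E
  distribute {B = B} {C} {E} d e =
    mp (mp (taut ((B ⇒ (C ⇒ E)) ⇒ ((B ⇒ C) ⇒ (B ⇒ E))) (S-taut B C E)) d) e

  compose : ∀ {X B C E} → X ⊢ C ⇒ E → X ⊢ B ⇒ C → X ⊢ B ⇒ E
  compose {B = B} d = distribute (const B d)

  by-cases : ∀ {X B C} → X ⊢ B ⇒ C → X ⊢ ¬ᶠ B ⇒ C → X ⊢ C
  by-cases {B = B} {C} d e = mp (mp (taut ((B ⇒ C) ⇒ ((¬ᶠ B ⇒ C) ⇒ C)) (cases-taut B C)) d) e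

  ex-falso : ∀ {X} C → X ⊢ ⊥ᶠ ⇒ C
  ex-falso C = taut (⊥ᶠ ⇒ C) (ex-falso-taut C)

  ∧-intro : ∀ {X B C} → X ⊢ B → X ⊢ C → X ⊢ B ∧ᶠ C
  ∧-intro {B = B} {C} d e = mp (mp (taut (B ⇒ (C ⇒ (B ∧ᶠ C))) (∧-intro-taut B C)) d) e

  ∧-elimˡ : ∀ {X} B C → X ⊢ (B ∧ᶠ C) ⇒ B
  ∧-elimˡ B C = taut ((B ∧ᶠ C) ⇒ B) (∧-elimˡ-taut B C)

  ∧-elimʳ : ∀ {X} B C → X ⊢ (B ∧ᶠ C) ⇒ C
  ∧-elimʳ B C = taut ((B ∧ᶠ C) ⇒ C) (∧-elimʳ-taut B C)

  deduction : ∀ {X B C} → X ∪ ｛ B ｝ ⊢ C → X ⊢ B ⇒ C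
  deduction {B = B} (hyp (inj₁ h))    = const B (hyp h)
  deduction {B = B} (hyp (inj₂ refl)) = identity B
  deduction {B = B} (thm t)           = const B (thm t)
  deduction         (mp d e)          = distribute (deduction d) (deduction e)

  -- C is the conjunction of the finitely many hypotheses used from Y, with `¬ᶠ ⊥ᶠ` as the empty
  -- conjunction. A single formula is needed when `DS` is applied.
  interpolate : ∀ {X Y B} → X ∪ Y ⊢ B → ∃ λ C → Y ⊢ C × X ⊢ C ⇒ B
  interpolate (hyp (inj₁ h))     = ¬ᶠ ⊥ᶠ , identity ⊥ᶠ , const _ (hyp h)
  interpolate (hyp {B} (inj₂ h)) = B , hyp h , identity B
  interpolate (thm t)            = ¬ᶠ ⊥ᶠ , identity ⊥ᶠ , const _ (thm t)
  interpolate (mp d e) with interpolate d | interpolate e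
  ... | C , c , f | C′ , c′ , f′ =
    C ∧ᶠ C′ , ∧-intro c c′ , distribute (compose f (∧-elimˡ C C′)) (compose f′ (∧-elimʳ C C′))

  -- Complete consistent sets. Boolean membership makes them decidable, so they can be recorded as
  -- lists of truth values and membership is stable under double negation.
  record Theory : Set where
    field mem : Form → Bool

    infix 4 _∈ₜ
    _∈ₜ : Pred Form 0ℓ
    B ∈ₜ = mem B ≡ true

    field
      ∈-thm : ∀ {B} → B ∈ L → B ∈ₜ
      ∈-mp  : ∀ {B C} → B ⇒ C ∈ₜ → B ∈ₜ → C ∈ₜ
      ⊥∉    : ¬ ⊥ᶠ ∈ₜ
      ∈-neg : ∀ B → B ∈ₜ ⊎ ¬ᶠ B ∈ₜ

  ⟪_⟫ : Theory → Pred Form 0ℓ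
  ⟪ Δ ⟫ B = Theory.mem Δ B ≡ true

  -- The consequences of a maximal set from which G is not derivable.
  module Lindenbaum (em : ExcludedMiddle 0ℓ) (G : Form) where
    -- B enters only if G remains underivable. The condition sits inside the predicate, so the set
    -- is defined without a case distinction.
    step : Pred Form 0ℓ → Form → Pred Form 0ℓ
    step X B = X ∪ λ C → B ≡ C × ¬ (X ∪ ｛ B ｝ ⊢ G)

    step-⊬ : ∀ X B → ¬ (X ⊢ G) → ¬ (step X B ⊢ G)
    step-⊬ X B n d = m (weaken (map₂ proj₁) d)
      where
      -- If X together with B derived G, `step` would add nothing, and `d` would already be a
      -- derivation from X.
      m : ¬ (X ∪ ｛ B ｝ ⊢ G)
      m e = n (weaken [ id , (λ (_ , m′) → contradiction e m′) ] d)

    steps : Pred Form 0ℓ → List Form → Pred Form 0ℓ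
    steps X []       = X
    steps X (B ∷ Bs) = steps (step X B) Bs

    steps-⊆ : ∀ {X} Bs → X ⊆ steps X Bs
    steps-⊆ []       = id
    steps-⊆ (B ∷ Bs) = steps-⊆ Bs ∘ inj₁

    steps-⊬ : ∀ {X} Bs → ¬ (X ⊢ G) → ¬ (steps X Bs ⊢ G)
    steps-⊬ []       n = n
    steps-⊬ (B ∷ Bs) n = steps-⊬ Bs (step-⊬ _ B n)

    steps-decide : ∀ {X B} Bs → B List.∈ Bs → ∃ λ Y → step Y B ⊆ steps X Bs
    steps-decide (B ∷ Bs) (here refl) = _ , steps-⊆ Bs
    steps-decide (_ ∷ Bs) (there i)   = steps-decide Bs i

    module _ (X : Pred Form 0ℓ) (X⊬G : ¬ (X ⊢ G)) where
      stage : ℕ → Pred Form 0ℓ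
      stage zero      = X
      stage (ℕ.suc n) = steps (stage n) (forms n)

      stage-⊬ : ∀ n → ¬ (stage n ⊢ G)
      stage-⊬ zero      = X⊬G
      stage-⊬ (ℕ.suc n) = steps-⊬ (forms n) (stage-⊬ n)

      stage-mono : ∀ {m n} → m ≤′ n → stage m ⊆ stage n
      stage-mono ≤′-refl           = id
      stage-mono (≤′-step {n} m≤n) = steps-⊆ (forms n) ∘ stage-mono m≤n

      limit : Pred Form 0ℓ
      limit B = ∃ λ n → stage n B

      compactness : ∀ {B} → limit ⊢ B → ∃ λ n → stage n ⊢ B
      compactness (hyp (n , h)) = n , hyp h
      compactness (thm t)       = 0 , thm t
      compactness (mp d e) with compactness d | compactness e
      ... | m , d′ | n , e′ = m ⊔ n ,
        mp (weaken (stage-mono (≤⇒≤′ (m≤m⊔n m n))) d′) (weaken (stage-mono (≤⇒≤′ (m≤n⊔m m n))) e′)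

      limit-⊬ : ¬ (limit ⊢ G)
      limit-⊬ d = let n , d′ = compactness d in stage-⊬ n d′

      -- Let Y be the set at the moment B is treated. Either B is added to it, or Y with B derives G
      -- and the deduction theorem applies.
      maximal : ∀ B → limit ⊢ B ⊎ limit ⊢ B ⇒ G
      maximal B with steps-decide (forms (rank B)) (∈-forms B ≤-refl)
      ... | Y , Y⊆ with em {Y ∪ ｛ B ｝ ⊢ G}
      ... | yes d = inj₂ (deduction (weaken (map₁ λ h → ℕ.suc (rank B) , Y⊆ (inj₁ h)) d))
      ... | no  n = inj₁ (hyp (ℕ.suc (rank B) , Y⊆ (inj₂ (refl , n))))

      negation-complete : ∀ B → limit ⊢ B ⊎ limit ⊢ ¬ᶠ B
      negation-complete B with maximal B | maximal (¬ᶠ B)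
      ... | inj₁ d | _      = inj₁ d
      ... | inj₂ _ | inj₁ e = inj₂ e
      ... | inj₂ d | inj₂ e = contradiction (by-cases d e) limit-⊬

      lindenbaum : ∃ λ Δ → X ⊆ ⟪ Δ ⟫ × ¬ ⟪ Δ ⟫ G
      lindenbaum = record
        { mem   = λ B → does (em {limit ⊢ B})
        ; ∈-thm = λ t → dec-true em (thm t)
        ; ∈-mp  = λ d e → dec-true em (mp (does⁻ em d) (does⁻ em e))
        ; ⊥∉    = λ d → limit-⊬ (mp (ex-falso G) (does⁻ em d))
        ; ∈-neg = λ B → Sum.map (dec-true em) (dec-true em) (negation-complete B)
        } , (λ h → dec-true em (hyp (0 , h))) , limit-⊬ ∘ does⁻ em

  open Lindenbaum using (lindenbaum) public

-- The canonical model of S4DS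

open Derivability {S4DS} (Least-isLogic _)

pair : Form → Form → ℕ → Form
pair B C zero      = B
pair B C (ℕ.suc _) = C

module _ (B : Form) where
  instantiate : ∀ {E} → E ∈ S4DS → (E [ (λ _ → B) ]) ∈ S4DS
  instantiate = substitution (λ _ → B)

  B-D∈ : (B ⇒ [≠] (⟨≠⟩ B)) ∈ S4DS
  B-D∈ = instantiate (axiom (inj₁ (axiom (inj₂ (here refl)))))

  4⁻-D∈ : ((B ∧ᶠ ([≠] B)) ⇒ [≠] ([≠] B)) ∈ S4DS
  4⁻-D∈ = instantiate (axiom (inj₁ (axiom (inj₂ (there (here refl))))))

  D-□∈ : ([∀] B ⇒ □ B) ∈ S4DS
  D-□∈ = instantiate (axiom (inj₁ (axiom (inj₂ (there (there (here refl)))))))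

  T-□∈ : (□ B ⇒ B) ∈ S4DS
  T-□∈ = instantiate (axiom (inj₁ (axiom (inj₂ (there (there (there (here refl))))))))

  4-□∈ : (□ B ⇒ □ (□ B)) ∈ S4DS
  4-□∈ = instantiate (axiom (inj₁ (axiom (inj₂ (there (there (there (there (here refl)))))))))

  DS∈ : ([≠] B ⇒ ◇ B) ∈ S4DS
  DS∈ = instantiate (axiom (inj₂ refl))

open Theory

closed : ∀ Δ → (⟪ Δ ⟫ ⊢_) ⊆ ⟪ Δ ⟫
closed Δ (hyp h)  = h
closed Δ (thm t)  = ∈-thm Δ t
closed Δ (mp d e) = ∈-mp Δ (closed Δ d) (closed Δ e)

∉⇒¬∈ : ∀ Δ {B} → ¬ ⟪ Δ ⟫ B → ⟪ Δ ⟫ (¬ᶠ B)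
∉⇒¬∈ Δ {B} n = [ (λ b → contradiction b n) , id ] (∈-neg Δ B)

¬∈⇒∉ : ∀ Δ {B} → ⟪ Δ ⟫ (¬ᶠ B) → ¬ ⟪ Δ ⟫ B
¬∈⇒∉ Δ n b = ⊥∉ Δ (∈-mp Δ n b)

∈-stable : ∀ Δ {B} → ¬ ¬ ⟪ Δ ⟫ B → ⟪ Δ ⟫ B
∈-stable Δ {B} = decidable-stable (mem Δ B Bool.≟ true)

-- A complete theory is maximal: a formula missing from Δ has its negation in Δ, hence in Θ.
⊆⇒≗ : ∀ Δ Θ → ⟪ Δ ⟫ ⊆ ⟪ Θ ⟫ → ∀ B → mem Δ B ≡ mem Θ B
⊆⇒≗ Δ Θ Δ⊆Θ B with ∈-neg Δ B
... | inj₁ b = trans b (sym (Δ⊆Θ b))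
... | inj₂ n = trans (Bool.¬-not (¬∈⇒∉ Δ n)) (sym (Bool.¬-not (¬∈⇒∉ Θ (Δ⊆Θ n))))

-- A derivation can be boxed throughout: hypotheses are boxed in Δ by assumption, theorems by
-- generalization, and modus ponens by the K axiom.
□-closed : ∀ Δ {B} → (⟪ Δ ⟫ ∘ □_) ⊢ B → ⟪ Δ ⟫ (□ B)
□-closed Δ (hyp h)  = h
□-closed Δ (thm t)  = ∈-thm Δ (gen-□ t)
□-closed Δ (mp {B} {C} d e) =
  ∈-mp Δ (∈-mp Δ (∈-thm Δ (substitution (pair B C) k-□)) (□-closed Δ d)) (□-closed Δ e)

≠-closed : ∀ Δ {B} → (⟪ Δ ⟫ ∘ [≠]_) ⊢ B → ⟪ Δ ⟫ ([≠] B)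
≠-closed Δ (hyp h)  = h
≠-closed Δ (thm t)  = ∈-thm Δ (gen-≠ t)
≠-closed Δ (mp {B} {C} d e) =
  ∈-mp Δ (∈-mp Δ (∈-thm Δ (substitution (pair B C) k-≠)) (≠-closed Δ d)) (≠-closed Δ e)

-- The canonical relations of □, [≠] and [∀].
_R_ _D_ _E_ : Theory → Theory → Set
Δ R Θ = ∀ {B} → ⟪ Δ ⟫ (□ B) → ⟪ Θ ⟫ B
Δ D Θ = ∀ {B} → ⟪ Δ ⟫ ([≠] B) → ⟪ Θ ⟫ B
Δ E Θ = ∀ {B} → ⟪ Δ ⟫ ([≠] B) → ⟪ Δ ⟫ B → ⟪ Θ ⟫ B

D⇒E : ∀ {Δ Θ} → Δ D Θ → Δ E Θ
D⇒E ΔDΘ nb _ = ΔDΘ nb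

R⇒E : ∀ Δ {Θ} → Δ R Θ → Δ E Θ
R⇒E Δ ΔRΘ {B} nb b = ΔRΘ (∈-mp Δ (∈-thm Δ (D-□∈ B)) (closed Δ (∧-intro (hyp nb) (hyp b))))

-- `4⁻-D` puts `[≠] ([≠] B)` into Δ, so both `[≠] B` and B pass to Θ.
E-trans : ∀ {Δ Θ Ξ} → Δ E Θ → Θ E Ξ → Δ E Ξ
E-trans {Δ} ΔEΘ ΘEΞ {B} nb b =
  ΘEΞ (ΔEΘ (∈-mp Δ (∈-thm Δ (4⁻-D∈ B)) (closed Δ (∧-intro (hyp b) (hyp nb)))) nb) (ΔEΘ nb b)

-- If `[≠] B` is in Δ, then so are `¬ᶠ C ⇒ B` and its `[≠]`, the former because C is in Δ. Hence E
-- carries the implication to Θ, where `¬ᶠ C` holds.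
E-separated⇒D : ∀ Δ Θ → Δ E Θ → ∀ {C} → ⟪ Δ ⟫ C → ¬ ⟪ Θ ⟫ C → Δ D Θ
E-separated⇒D Δ Θ ΔEΘ {C} c c∉Θ {B} nb = ∈-mp Θ ¬C⇒B∈Θ (∉⇒¬∈ Θ c∉Θ)
  where
  ¬C⇒B∈Θ : ⟪ Θ ⟫ (¬ᶠ C ⇒ B)
  ¬C⇒B∈Θ = ΔEΘ (≠-closed Δ (const (¬ᶠ C) (hyp nb)))
    (closed Δ (compose (ex-falso B) (distribute (identity (¬ᶠ C)) (const (¬ᶠ C) (hyp c)))))

-- If B were not in Δ, it would separate the two theories, giving `Δ D Θ`. By `B-D` the formula
-- `⟨≠⟩ (¬ᶠ B)` would then be in Θ, against `[≠] B`.
E-sym : ∀ Δ Θ → Δ E Θ → Θ E Δ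
E-sym Δ Θ ΔEΘ {B} nb b = ∈-stable Δ λ b∉Δ →
  let ¬b = ∉⇒¬∈ Δ b∉Δ
      ΔDΘ = E-separated⇒D Δ Θ ΔEΘ ¬b (λ n → ¬∈⇒∉ Θ n b)
      ¬¬B = distribute (identity (¬ᶠ B)) (const (¬ᶠ B) (hyp nb))
  in ¬∈⇒∉ Θ (ΔDΘ (∈-mp Δ (∈-thm Δ (B-D∈ (¬ᶠ B))) ¬b)) (≠-closed Θ ¬¬B)

module Canonical (em : ExcludedMiddle 0ℓ) where

  □-witness : ∀ Δ {B} → ¬ ⟪ Δ ⟫ (□ B) → ∃ λ Θ → Δ R Θ × ¬ ⟪ Θ ⟫ B
  □-witness Δ {B} n = let Θ , ΔRΘ , b∉Θ = lindenbaum em B _ (n ∘ □-closed Δ) in Θ , ΔRΘ , b∉Θ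

  ≠-witness : ∀ Δ {B} → ¬ ⟪ Δ ⟫ ([≠] B) → ∃ λ Θ → Δ D Θ × ¬ ⟪ Θ ⟫ B
  ≠-witness Δ {B} n = let Θ , ΔDΘ , b∉Θ = lindenbaum em B _ (n ∘ ≠-closed Δ) in Θ , ΔDΘ , b∉Θ

  -- A single theory must serve both relations. Were the combined demands inconsistent,
  -- interpolation would give C with `[≠] C` and `□ (¬ᶠ C)` in Δ, against `DS`.
  DS-witness : ∀ Δ → ∃ λ Θ → Δ R Θ × Δ D Θ
  DS-witness Δ = let Θ , h , _ = lindenbaum em ⊥ᶠ _ consistent in Θ , h ∘ inj₁ , h ∘ inj₂
    where
    consistent : ¬ ((⟪ Δ ⟫ ∘ □_) ∪ (⟪ Δ ⟫ ∘ [≠]_) ⊢ ⊥ᶠ)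
    consistent d with interpolate d
    ... | C , c , ¬c = ¬∈⇒∉ Δ (∈-mp Δ (∈-thm Δ (DS∈ C)) (≠-closed Δ c)) (□-closed Δ ¬c)

  E⇒D⊎≗ : ∀ Δ Θ → Δ E Θ → Δ D Θ ⊎ (∀ B → mem Δ B ≡ mem Θ B)
  E⇒D⊎≗ Δ Θ ΔEΘ with em {∃ λ C → ⟪ Δ ⟫ C × ¬ ⟪ Θ ⟫ C}
  ... | yes (_ , c , c∉Θ) = inj₁ (E-separated⇒D Δ Θ ΔEΘ c c∉Θ)
  ... | no n = inj₂ (⊆⇒≗ Δ Θ λ c → ∈-stable Θ λ c∉Θ → n (_ , c , c∉Θ))

-- The space refuting A

subformulas : Form → List Form
subformulas (var n) = var n ∷ []
subformulas ⊥ᶠ      = ⊥ᶠ ∷ []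
subformulas (B ⇒ C) = (B ⇒ C) ∷ subformulas B ++ subformulas C
subformulas (□ B)   = □ B ∷ subformulas B
subformulas ([≠] B) = [≠] B ∷ subformulas B

self-subformula : ∀ B → B List.∈ subformulas B
self-subformula (var n) = here refl
self-subformula ⊥ᶠ      = here refl
self-subformula (B ⇒ C) = here refl
self-subformula (□ B)   = here refl
self-subformula ([≠] B) = here refl

map-≡⇒≗ : ∀ {a b} {X : Set a} {Y : Set b} {f g : X → Y} xs →
          map f xs ≡ map g xs → ∀ {x} → x List.∈ xs → f x ≡ g x
map-≡⇒≗ (x ∷ xs) e (here refl) = ∷-injectiveˡ e
map-≡⇒≗ (x ∷ xs) e (there i)   = map-≡⇒≗ xs (∷-injectiveʳ e) i

module Countermodel (ℓ : Level) (em : ExcludedMiddle 0ℓ) (Γ : Theory) (A : Form) where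
  open Canonical em

  -- Codes the filtration class of a theory, so that the quotient has decidable propositional
  -- equality.
  profile : Theory → List Bool
  profile Δ = map (mem Δ) (subformulas A)

  Realized : Pred (List Bool) 0ℓ
  Realized v = ∃ λ Δ → Γ E Δ × profile Δ ≡ v

  -- The class is related to itself in the minimal filtration of D; the two witnesses may be
  -- different theories.
  Reflexive : Pred (List Bool) 0ℓ
  Reflexive v = ∃₂ λ Δ Θ → profile Δ ≡ v × profile Θ ≡ v × Δ D Θ

  -- A profile has a second copy exactly when it is D-reflexive. The proofs are
  -- irrelevant, so that a point is determined by its profile and copy.
  record Point : Set ℓ where
    constructor point
    field
      code      : List Bool
      copy      : Bool
      .realized : Realized code
      .doubled  : copy ≡ true → Reflexive code

  open Point using (code; copy)

  Point-≡ : ∀ {x y} → code x ≡ code y → copy x ≡ copy y → x ≡ y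
  Point-≡ refl refl = refl

  -- Excluded middle decides `Realized`, which allows a witness to be recovered from the irrelevant
  -- field.
  realizer : ∀ x → Realized (code x)
  realizer (point _ _ r _) = recompute em r

  copied⇒reflexive : ∀ x → copy x ≡ true → Reflexive (code x)
  copied⇒reflexive (point _ _ _ d) e = recompute em (d e)

  theory : Point → Theory
  theory x = proj₁ (realizer x)

  Γ-E-theory : ∀ x → Γ E theory x
  Γ-E-theory x = proj₁ (proj₂ (realizer x))

  profile-theory : ∀ x → profile (theory x) ≡ code x
  profile-theory x = proj₂ (proj₂ (realizer x))

  theories-E : ∀ x y → theory x E theory y
  theories-E x y =
    E-trans {theory x} {Γ} {theory y} (E-sym Γ (theory x) (Γ-E-theory x)) (Γ-E-theory y)

  same-profile : ∀ Δ Θ → profile Δ ≡ profile Θ →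
                 ∀ {B} → B List.∈ subformulas A → ⟪ Δ ⟫ B → ⟪ Θ ⟫ B
  same-profile Δ Θ e i b = trans (sym (map-≡⇒≗ (subformulas A) e i)) b

  same-code : ∀ x y → code x ≡ code y → ∀ {B} → B List.∈ subformulas A →
              ⟪ theory x ⟫ B → ⟪ theory y ⟫ B
  same-code x y e = same-profile (theory x) (theory y)
    (trans (profile-theory x) (trans e (sym (profile-theory y))))

  original : ∀ Δ → Γ E Δ → Point
  original Δ ΓEΔ = point (profile Δ) false (Δ , ΓEΔ , refl) λ ()

  original-agrees : ∀ Δ (ΓEΔ : Γ E Δ) {B} → B List.∈ subformulas A →
                    ⟪ theory (original Δ ΓEΔ) ⟫ B → ⟪ Δ ⟫ B
  original-agrees Δ ΓEΔ = same-profile (theory (original Δ ΓEΔ)) Δ (profile-theory (original Δ ΓEΔ))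

  original-agrees⁻ : ∀ Δ (ΓEΔ : Γ E Δ) {B} → B List.∈ subformulas A →
                     ⟪ Δ ⟫ B → ⟪ theory (original Δ ΓEΔ) ⟫ B
  original-agrees⁻ Δ ΓEΔ = same-profile Δ (theory (original Δ ΓEΔ)) (sym (profile-theory (original Δ ΓEΔ)))

  other-copy : ∀ x → Reflexive (code x) → Point
  other-copy (point v c ρ _) r = point v (not c) ρ λ _ → r

  other-copy-≢ : ∀ x r → other-copy x r ≢ x
  other-copy-≢ x r e = Bool.not-¬ {copy x} refl (sym (cong copy e))

  -- If Θ has another profile, its original point is distinct from x. Otherwise the code of x is
  -- D-reflexive, and the other copy of x stands in for Θ.
  D-successor : ∀ x Θ → theory x D Θ → ∃ λ y → y ≢ x ×
    (∀ {B} → B List.∈ subformulas A → ⟪ theory y ⟫ B → ⟪ Θ ⟫ B) ×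
    (∀ {B} → B List.∈ subformulas A → ⟪ Θ ⟫ B → ⟪ theory y ⟫ B)
  D-successor x Θ xDΘ with ≡-dec Bool._≟_ (profile Θ) (code x)
  ... | no n = original Θ ΓEΘ , (λ e → n (cong code e)) , original-agrees Θ ΓEΘ , original-agrees⁻ Θ ΓEΘ
    where
    ΓEΘ : Γ E Θ
    ΓEΘ = E-trans {Γ} {theory x} {Θ} (Γ-E-theory x) (D⇒E {theory x} {Θ} xDΘ)
  ... | yes e = y , other-copy-≢ x r , same-profile (theory y) Θ (trans e′ (sym e))
                  , same-profile Θ (theory y) (trans e (sym e′))
    where
    r : Reflexive (code x)
    r = theory x , Θ , profile-theory x , e , xDΘ
    y : Point
    y = other-copy x r
    e′ : profile (theory y) ≡ code x
    e′ = profile-theory y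

  -- Different codes mean different theories, which E then makes D-related. With equal codes one
  -- point is a second copy, so the class contains a D-related pair Δ, Θ, and the formulas travel
  -- through it.
  ≢⇒D : ∀ {x y} → y ≢ x → ∀ {B} → [≠] B List.∈ subformulas A → B List.∈ subformulas A →
        ⟪ theory x ⟫ ([≠] B) → ⟪ theory y ⟫ B
  ≢⇒D {x} {y} y≢x {B} i j nb with ≡-dec Bool._≟_ (code y) (code x)
  ... | no n with E⇒D⊎≗ (theory x) (theory y) (theories-E x y)
  ...   | inj₁ xDy = xDy nb
  ...   | inj₂ e = contradiction
    (trans (sym (profile-theory y)) (trans (sym (map-cong e (subformulas A))) (profile-theory x))) n
  ≢⇒D {x} {y} y≢x {B} i j nb | yes e with reflexive
    where
    reflexive : Reflexive (code x)
    reflexive with copy x in cx | copy y in cy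
    ... | true  | _     = copied⇒reflexive x cx
    ... | false | true  = subst Reflexive e (copied⇒reflexive y cy)
    ... | false | false = contradiction (Point-≡ e (trans cy (sym cx))) y≢x
  ... | Δ , Θ , δ , θ , ΔDΘ =
    same-profile Θ (theory y) (trans θ (trans (sym e) (sym (profile-theory y)))) j
      (ΔDΘ (same-profile (theory x) Δ (trans (profile-theory x) (sym δ)) i nb))

  -- Lemmon's filtration: comparing boxed formulas with boxed formulas makes this a preorder by its
  -- form. `4-□` places R inside it, and `T-□` later removes the box.
  _≼_ : Point → Point → Set
  x ≼ y = ∀ {B} → □ B List.∈ subformulas A → ⟪ theory x ⟫ (□ B) → ⟪ theory y ⟫ (□ B)

  R⇒≼ : ∀ x y Θ → theory x R Θ →
        (∀ {B} → B List.∈ subformulas A → ⟪ Θ ⟫ B → ⟪ theory y ⟫ B) → x ≼ y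
  R⇒≼ x y Θ xRΘ Θ⊆y {B} i nb =
    Θ⊆y i (xRΘ (∈-mp (theory x) (∈-thm (theory x) (4-□∈ B)) nb))

  space : Space ℓ
  space = record
    { Carrier     = Point
    ; Open        = λ U → ∀ x y → x ≼ y → U x → U y
    ; Open-resp-≐ = λ (U⊆V , V⊆U) o x y x≼y → U⊆V ∘ o x y x≼y ∘ V⊆U
    ; Open-∅      = λ _ _ _ u → u
    ; Open-U      = λ _ _ _ u → u
    ; Open-∩      = λ o o′ x y x≼y (u , v) → o x y x≼y u , o′ x y x≼y v
    ; Open-⋃      = λ I U o x y x≼y (i , u) → i , o i x y x≼y u
    }

  -- The theory from `DS-witness` is represented by some y distinct from x, by D, and above x, by R.
  -- An open set containing x therefore contains y as well.
  dense-in-itself : DenseInItself space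
  dense-in-itself x isolated =
    let Θ , xRΘ , xDΘ = DS-witness (theory x)
        y , y≢x , _ , Θ⊆y = D-successor x Θ xDΘ
    in y≢x (sym (isolated x y (R⇒≼ x y Θ xRΘ Θ⊆y) refl))

  -- The truth lemma

  valuation : Valuation space
  valuation n x = Lift ℓ (⟪ theory x ⟫ (var n))

  infix 4 _⊩_
  _⊩_ : Point → Form → Set (suc ℓ)
  x ⊩ B = _,_⊨_ space valuation x B

  -- The two directions are proved together because implication swaps them; the inclusion keeps the
  -- induction within the subformulas of A, where profiles decide membership.
  truth  : ∀ B → (List._∈ subformulas B) ⊆ (List._∈ subformulas A) → ∀ x → x ⊩ B → ⟪ theory x ⟫ B
  truth⁻ : ∀ B → (List._∈ subformulas B) ⊆ (List._∈ subformulas A) → ∀ x → ⟪ theory x ⟫ B → x ⊩ B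

  truth (var n) s x (lift (lift h)) = h
  truth (B ⇒ C) s x h with ∈-neg (theory x) B
  ... | inj₁ b = closed Δ (const B (hyp (truth C (s ∘ there ∘ ∈-++⁺ʳ (subformulas B)) x
                   (h (truth⁻ B (s ∘ there ∘ ∈-++⁺ˡ) x b)))))
    where Δ = theory x
  ... | inj₂ n = closed (theory x) (compose (ex-falso C) (hyp n))
  truth (□ B) s x (W , (V , V-open , x∈V , V⊆W) , h) = ∈-stable (theory x) λ n →
    let Θ , xRΘ , b∉Θ = □-witness (theory x) n
        ΓEΘ = λ {C} → E-trans {Γ} {theory x} {Θ} (Γ-E-theory x) (R⇒E (theory x) {Θ} xRΘ) {C}
        y = original Θ ΓEΘ
        y∈W = V⊆W (V-open x y (R⇒≼ x y Θ xRΘ (original-agrees⁻ Θ ΓEΘ)) x∈V)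
    in b∉Θ (original-agrees Θ ΓEΘ (s (there (self-subformula B)))
              (truth B (s ∘ there) y (h y y∈W)))
  truth ([≠] B) s x h = ∈-stable (theory x) λ n →
    let Θ , xDΘ , b∉Θ = ≠-witness (theory x) n
        y , y≢x , y⊆Θ , _ = D-successor x Θ xDΘ
    in b∉Θ (y⊆Θ (s (there (self-subformula B))) (truth B (s ∘ there) y (h y y≢x)))

  truth⁻ (var n) s x h = lift (lift h)
  truth⁻ ⊥ᶠ s x h = contradiction h (⊥∉ (theory x))
  truth⁻ (B ⇒ C) s x h b = truth⁻ C (s ∘ there ∘ ∈-++⁺ʳ (subformulas B)) x
    (∈-mp (theory x) h (truth B (s ∘ there ∘ ∈-++⁺ˡ) x b))
  truth⁻ (□ B) s x h =
    -- The points above x form the smallest open neighborhood of x.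
    U , (U , U-open , lift (λ _ b → b) , id) ,
    λ y (lift x≼y) → truth⁻ B (s ∘ there) y
      (∈-mp (theory y) (∈-thm (theory y) (T-□∈ B)) (x≼y (s (here refl)) h))
    where
    U : Pred Point ℓ
    U y = Lift ℓ (x ≼ y)
    U-open : Space.Open space U
    U-open y z y≼z (lift x≼y) = lift λ i → y≼z i ∘ x≼y i
  truth⁻ ([≠] B) s x h y y≢x =
    truth⁻ B (s ∘ there) y (≢⇒D y≢x (s (here refl)) (s (there (self-subformula B))) h)

  refuted : ¬ ⟪ Γ ⟫ A → ¬ Valid space A
  refuted A∉Γ v = A∉Γ (original-agrees Γ Γ-refl (self-subformula A)
    (truth A id (original Γ Γ-refl) (v valuation (original Γ Γ-refl))))
    where
    Γ-refl : Γ E Γ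
    Γ-refl _ b = b

-- Soundness and completeness combined

theorem6p8 : (ℓ : Level) → ExcludedMiddle (suc ℓ) → (A : Form) → (A ∈ S4DS) ⇔ (A ∈ D-logic (DenseInItself {ℓ}))
theorem6p8 ℓ em A = mk⇔ (λ d X dense → Soundness.S4DS-valid em X dense d) complete
  where
  em₀ : ExcludedMiddle 0ℓ
  em₀ {P} = map′ lower lift (em {Lift (suc ℓ) P})

  ⊢⇒S4DS : ∀ {B} → S4DS ⊢ B → B ∈ S4DS
  ⊢⇒S4DS (hyp h)  = h
  ⊢⇒S4DS (thm t)  = t
  ⊢⇒S4DS (mp d e) = modusPonens (⊢⇒S4DS d) (⊢⇒S4DS e)

  complete : A ∈ D-logic (DenseInItself {ℓ}) → A ∈ S4DS
  complete valid = decidable-stable em₀ λ A∉S4DS →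
    -- With the logic itself as hypotheses, derivability collapses to membership, so A is
    -- underivable and some complete theory omits it.
    let Γ , _ , A∉Γ = lindenbaum em₀ A S4DS (A∉S4DS ∘ ⊢⇒S4DS)
        open Countermodel ℓ em₀ Γ A
    in refuted A∉Γ (valid space dense-in-itself)
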